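{- Let $p,q,k$ be positive integers such that $\gcd(p+q,\ell)\leq p$ for every integer $1\leq \ell \leq k$. Then there exists an integer $N=N(p,q,k)$ such that for every integer $n\geq N$ and for all positive integers $b_1\leq b_2 \leq \ldots \leq b_n$ with $b_{N} \leq k$, Enforcer has a winning strategy in the game $mBox(b_1, \ldots, b_n,(p,q))$, both when Enforcer is the first player and when he is the second player.
   Context: A $(p,q)$ Avoider-Enforcer game on a finite board $X$ with a family $\mathcal F\subseteq 2^X$ of target sets is played as follows (strict rules): Avoider and Enforcer alternately claim exactly $p$ and exactly $q$ previously unclaimed elements of $X$ per move, respectively; if before a player's move fewer than $p$ (for Avoider) or $q$ (for Enforcer) unclaimed elements remain, that player claims all of them. It is specified which player moves first. The game ends when all elements are claimed; Avoider loses (Enforcer wins) if at the end Avoider has claimed all elements of some target set, otherwise Avoider wins. The misère box game $mBox(b_1,\ldots,b_n,(p,q))$ is the $(p,q)$ Avoider-Enforcer game (strict rules) whose board is the disjoint union of pairwise disjoint sets (boxes) $B_1,\ldots,B_n$ with $|B_i|=b_i$, and whose target sets are exactly $B_1,\ldots,B_n$. -}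

module Defs where

open import Data.Nat using (ℕ; zero; suc; _+_; _⊓_; _≤ᵇ_; _<ᵇ_)
open import Data.Bool using (Bool; true; false; _∧_)
open import Data.Fin using (Fin; zero; suc; toℕ)
open import Data.Fin.Subset using (Subset; Side; inside; outside; _∈_; ∣_∣)
open import Data.Vec using (Vec; []; _∷_; lookup; replicate; tabulate; zipWith)
open import Data.Product using (Σ; _×_)
open import Relation.Binary.PropositionalEquality using (_≡_)
open import Relation.Nullary using (¬_)
open import Function using (_∘_)

data Owner : Set where
  unclaimed : Owner
  byAvoider : Owner
  byEnforcer : Owner

data Player : Set where
  Avoider : Player
  Enforcer : Player

Position : ℕ → Set
Position m = Vec Owner m

freeCount : ∀ {m} → Position m → ℕ
freeCount [] = 0
freeCount (unclaimed ∷ ps) = suc (freeCount ps)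
freeCount (byAvoider ∷ ps) = freeCount ps
freeCount (byEnforcer ∷ ps) = freeCount ps

AllClaimed : ∀ {m} → Position m → Set
AllClaimed pos = freeCount pos ≡ 0

-- A legal move claiming r elements under strict rules: a set of
-- unclaimed elements of size exactly min(r, #unclaimed).
LegalMove : ∀ {m} → ℕ → Position m → Subset m → Set
LegalMove {m} r pos S =
  ((x : Fin m) → x ∈ S → lookup pos x ≡ unclaimed) × (∣ S ∣ ≡ r ⊓ freeCount pos)

claimStep : Owner → Side → Owner → Owner
claimStep o inside _ = o
claimStep o outside c = c

claim : ∀ {m} → Owner → Subset m → Position m → Position m
claim o S pos = zipWith (claimStep o) S pos

AvoiderClaimedTarget : ∀ {m t} → (Fin t → Subset m) → Position m → Set
AvoiderClaimedTarget {m} F pos =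
  Σ _ λ i → (x : Fin m) → x ∈ F i → lookup pos x ≡ byAvoider

data EnforcerWinsFrom {m t : ℕ} (p q : ℕ) (F : Fin t → Subset m)
       : Player → Position m → Set where
  gameOver : ∀ {pl pos} → AllClaimed pos → AvoiderClaimedTarget F pos →
             EnforcerWinsFrom p q F pl pos
  avoiderMove : ∀ {pos} → ¬ AllClaimed pos →
    ((S : Subset m) → LegalMove p pos S →
       EnforcerWinsFrom p q F Enforcer (claim byAvoider S pos)) →
    EnforcerWinsFrom p q F Avoider pos
  enforcerMove : ∀ {pos} → ¬ AllClaimed pos → (S : Subset m) →
    LegalMove q pos S →
    EnforcerWinsFrom p q F Avoider (claim byEnforcer S pos) →
    EnforcerWinsFrom p q F Enforcer pos

EnforcerWins : ∀ {m t} → (p q : ℕ) → (Fin t → Subset m) → Player → Set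
EnforcerWins {m} p q F first = EnforcerWinsFrom p q F first (replicate m unclaimed)

-- Misère box game mBox(b_1,...,b_n,(p,q)): the board Fin (total b) is
-- split into consecutive disjoint intervals (boxes) of sizes b i.

total : ∀ {n} → (Fin n → ℕ) → ℕ
total {zero} b = 0
total {suc n} b = b zero + total (b ∘ suc)

offset : ∀ {n} → (Fin n → ℕ) → Fin n → ℕ
offset b zero = 0
offset b (suc i) = b zero + offset (b ∘ suc) i

toSide : Bool → Side
toSide true = inside
toSide false = outside

box : ∀ {n} → (b : Fin n → ℕ) → Fin n → Subset (total b)
box b i = tabulate λ x →
  toSide ((offset b i ≤ᵇ toℕ x) ∧ (toℕ x <ᵇ (offset b i + b i)))

EnforcerWinsMBox : ∀ {n} → (b : Fin n → ℕ) → (p q : ℕ) → Player → Set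
EnforcerWinsMBox b p q first = EnforcerWins p q (box b) first

{-# OPTIONS --safe #-}

-- Enforcer keeps a set L of live boxes that he has never touched; all other cells
-- are junk to him.  Suppose every live box has at most ℓ free cells, let T be the
-- number of free cells and D the deficit ℓ|L| − (free cells in live boxes).  Then
-- the number of free junk cells is T − ℓ|L| + D, so modulo ℓ it is T + D.  Enforcer
-- plays in junk only, turning full live boxes (exactly ℓ free cells) into junk when
-- he runs out.  After the original junk is used up the junk count stays below ℓ on
-- Avoider's turns, so while D is unchanged it runs through j, j − (p+q), … modulo ℓ,
-- and by Bézout soon falls below gcd (p+q) ℓ ≤ p.  Avoider must then play in a live
-- box, which increases D, at a cost of boundedly many live boxes.  Once D ≥ ℓM, at
-- least M live boxes have fewer than ℓ free cells, and induction on ℓ applies.  For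
-- ℓ = 0 Avoider already owns a live box.
module Submission where

open import Defs
open import Data.Nat using (ℕ; zero; suc; _+_; _*_; _∸_; _≤_; _<_; _⊓_; z≤n; s≤s; s≤s⁻¹; NonZero; ≢-nonZero; _≤?_; _<?_)
open import Data.Nat.Properties
open import Data.Nat.DivMod using (_/_; _%_; m≡m%n+[m/n]*n; m%n<n; m/n≤m)
open import Data.Nat.GCD using (gcd; gcd-GCD; gcd[m,n]≢0; module Bézout)
open import Data.Nat.Tactic.RingSolver using (solve-∀)
open import Algebra.Properties.CommutativeSemigroup +-commutativeSemigroup
  using (interchange; x∙yz≈y∙xz; x∙yz≈xz∙y; xy∙z≈xz∙y; xy∙z≈y∙xz)
open import Data.Bool using (true; T)
open import Data.Bool.Properties using (T-∧)
open import Data.Fin using (Fin; zero; suc; toℕ; fromℕ<; reduce≥) renaming (_≤_ to _≤ᶠ_)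
open import Data.Fin.Properties using (toℕ-fromℕ<)
open import Data.Fin.Subset using (Subset; inside; outside; _∈_; _∉_; _⊆_; ∣_∣; ∁; ⊥)
open import Data.Fin.Subset.Properties using (_∈?_; ⊆-refl; ⊆-trans; out⊆; s⊆s; x∉p⇒x∈∁p; x∈p⇒x∉∁p; ∉⊥)
open import Data.Vec using (Vec; []; _∷_; here; there; lookup; replicate; tabulate; map; _++_; updateAt)
open import Data.Vec.Properties using (lookup∘tabulate; lookup-replicate; lookup∘updateAt; []=⇒lookup; lookup-map; lookup-++-<; lookup-++-≥)
open import Data.Vec.Relation.Binary.Pointwise.Inductive as Pointwise using (Pointwise; []; _∷_)
open import Data.Product using (Σ; ∃-syntax; _×_; _,_; proj₁; proj₂)
open import Data.Sum as Sum using (_⊎_; inj₁; inj₂)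
open import Function using (_∘_)
open import Function.Bundles using (Equivalence)
open import Relation.Binary.PropositionalEquality
open import Relation.Nullary using (yes; no; contradiction)

-- Free cells counted over a set of boxes.

weight : ∀ {n} → Subset n → Vec ℕ n → ℕ
weight []            []      = 0
weight (inside  ∷ L) (r ∷ v) = r + weight L v
weight (outside ∷ L) (r ∷ v) = weight L v

_≼_ : ∀ {n} → Vec ℕ n → Vec ℕ n → Set
_≼_ = Pointwise _≤_

Bounded : ∀ {n} → ℕ → Subset n → Vec ℕ n → Set
Bounded ℓ L v = ∀ {i} → i ∈ L → lookup v i ≤ ℓ

weight-mono : ∀ {n} (L : Subset n) {u v} → u ≼ v → weight L u ≤ weight L v
weight-mono []            []          = z≤n
weight-mono (inside  ∷ L) (r≤s ∷ u≼v) = +-mono-≤ r≤s (weight-mono L u≼v)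
weight-mono (outside ∷ L) (_   ∷ u≼v) = weight-mono L u≼v

weight-⊥ : ∀ {n} (v : Vec ℕ n) → weight ⊥ v ≡ 0
weight-⊥ []      = refl
weight-⊥ (r ∷ v) = weight-⊥ v

weight-≤ : ∀ {n ℓ} (L : Subset n) {v} → Bounded ℓ L v → weight L v ≤ ℓ * ∣ L ∣
weight-≤ []            {[]}    bd = z≤n
weight-≤ {ℓ = ℓ} (inside  ∷ L) {r ∷ v} bd =
  ≤-trans (+-mono-≤ (bd here) (weight-≤ L (bd ∘ there))) (≤-reflexive (sym (*-suc ℓ ∣ L ∣)))
weight-≤ (outside ∷ L) {r ∷ v} bd = weight-≤ L (bd ∘ there)

weight-updateAt-∈ : ∀ {n} {L : Subset n} {i} v → i ∈ L → weight L (updateAt v i suc) ≡ suc (weight L v)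
weight-updateAt-∈ (r ∷ v) here = refl
weight-updateAt-∈ {L = inside ∷ L} (r ∷ v) (there i∈L) =
  trans (cong (r +_) (weight-updateAt-∈ v i∈L)) (+-suc r _)
weight-updateAt-∈ {L = outside ∷ L} (r ∷ v) (there i∈L) = weight-updateAt-∈ v i∈L

weight-updateAt-∉ : ∀ {n} {L : Subset n} {i} v → i ∉ L → weight L (updateAt v i suc) ≡ weight L v
weight-updateAt-∉ {L = inside  ∷ L} {zero}  (r ∷ v) i∉L = contradiction here i∉L
weight-updateAt-∉ {L = outside ∷ L} {zero}  (r ∷ v) i∉L = refl
weight-updateAt-∉ {L = inside  ∷ L} {suc i} (r ∷ v) i∉L =
  cong (r +_) (weight-updateAt-∉ v (i∉L ∘ there))
weight-updateAt-∉ {L = outside ∷ L} {suc i} (r ∷ v) i∉L = weight-updateAt-∉ v (i∉L ∘ there)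

-- Dropping full boxes and isolating smaller ones.

-- Every box that is not full contributes at least 1 to D, so D < |L| leaves a full one.
drop-full : ∀ {n ℓ} (L : Subset n) (v : Vec ℕ n) D → Bounded ℓ L v →
  weight L v + D ≡ ℓ * ∣ L ∣ → D < ∣ L ∣ →
  ∃[ L′ ] (L′ ⊆ L × suc ∣ L′ ∣ ≡ ∣ L ∣ × weight L′ v + D ≡ ℓ * ∣ L′ ∣ ×
           weight (∁ L′) v ≡ ℓ + weight (∁ L) v)
drop-full {ℓ = ℓ} (outside ∷ L) (r ∷ v) D bd bal D<L with drop-full L v D (bd ∘ there) bal D<L
... | L′ , L′⊆L , size , bal′ , junk =
  outside ∷ L′ , s⊆s L′⊆L , size , bal′ ,
  trans (cong (r +_) junk) (x∙yz≈y∙xz r ℓ _)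
drop-full {ℓ = ℓ} (inside ∷ L) (r ∷ v) D bd bal D<L with m≤n⇒∃[o]m+o≡n (bd here)
... | zero , r+0≡ℓ rewrite +-identityʳ r | r+0≡ℓ =
  outside ∷ L , out⊆ ⊆-refl , refl ,
  +-cancelˡ-≡ ℓ _ _ (trans (sym (+-assoc ℓ _ D)) (trans bal (*-suc ℓ ∣ L ∣))) , refl
... | suc e , refl with m≤n⇒∃[o]m+o≡n (e<D)
  where
  e<D : suc e ≤ D
  e<D = +-cancelˡ-≤ (r + weight L v) _ _ (begin
    r + weight L v + suc e    ≡⟨ xy∙z≈xz∙y r (weight L v) (suc e) ⟩
    r + suc e + weight L v    ≤⟨ +-monoʳ-≤ (r + suc e) (weight-≤ L (bd ∘ there)) ⟩
    r + suc e + (r + suc e) * ∣ L ∣ ≡⟨ sym (*-suc (r + suc e) ∣ L ∣) ⟩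
    (r + suc e) * suc ∣ L ∣   ≡⟨ sym bal ⟩
    r + weight L v + D        ∎)
    where
    open ≤-Reasoning
...   | D′ , refl with drop-full L v D′ (bd ∘ there) bal′ (≤-trans (s≤s (m≤n+m D′ e)) (s≤s⁻¹ D<L))
  where
  bal′ : weight L v + D′ ≡ (r + suc e) * ∣ L ∣
  bal′ = +-cancelˡ-≡ (r + suc e) _ _
    (trans (interchange r (suc e) (weight L v) D′) (trans bal (*-suc (r + suc e) ∣ L ∣)))
...     | L′ , L′⊆L , size , bal″ , junk =
  inside ∷ L′ , s⊆s L′⊆L , cong suc size ,
  trans (interchange r (weight L′ v) (suc e) D′) (trans (cong ((r + suc e) +_) bal″) (sym (*-suc (r + suc e) ∣ L′ ∣))) ,
  junk

-- `L′` collects the boxes of `L` that are not full. Only these contribute to `D`, and each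
-- contributes at most `suc ℓ`. This turns a large deficit into many boxes for the induction on the
-- box size.
smaller-boxes : ∀ {n ℓ} (L : Subset n) (v : Vec ℕ n) D → Bounded (suc ℓ) L v →
  weight L v + D ≡ suc ℓ * ∣ L ∣ →
  ∃[ L′ ] (L′ ⊆ L × Bounded ℓ L′ v × D ≤ suc ℓ * ∣ L′ ∣)
smaller-boxes {ℓ = ℓ} [] [] D bd bal = [] , ⊆-refl , (λ ()) , ≤-reflexive bal
smaller-boxes (outside ∷ L) (r ∷ v) D bd bal with smaller-boxes L v D (bd ∘ there) bal
... | L′ , L′⊆L , bd′ , D≤ = outside ∷ L′ , s⊆s L′⊆L , (λ { (there i∈L′) → bd′ i∈L′ }) , D≤
smaller-boxes {ℓ = ℓ} (inside ∷ L) (r ∷ v) D bd bal with r ≤? ℓ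
-- The tail is entered with its own deficit, since part of `D` belongs to the head box.
... | yes r≤ℓ with smaller-boxes L v (suc ℓ * ∣ L ∣ ∸ weight L v) (bd ∘ there) (m+[n∸m]≡n (weight-≤ L (bd ∘ there)))
...   | L′ , L′⊆L , bd′ , D≤ =
  inside ∷ L′ , s⊆s L′⊆L , (λ { here → r≤ℓ ; (there i∈L′) → bd′ i∈L′ }) , bound
  where
  open ≤-Reasoning
  w = weight L v
  bound : D ≤ suc ℓ * suc ∣ L′ ∣
  bound = +-cancelˡ-≤ (r + w) _ _ (begin
    r + w + D  ≡⟨ bal ⟩
    suc ℓ * suc ∣ L ∣ ≡⟨ *-suc (suc ℓ) ∣ L ∣ ⟩
    suc ℓ + suc ℓ * ∣ L ∣ ≡⟨ cong (suc ℓ +_) (sym (m+[n∸m]≡n (weight-≤ L (bd ∘ there)))) ⟩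
    suc ℓ + (w + (suc ℓ * ∣ L ∣ ∸ w)) ≤⟨ +-monoʳ-≤ (suc ℓ) (+-monoʳ-≤ w D≤) ⟩
    suc ℓ + (w + suc ℓ * ∣ L′ ∣) ≡⟨ x∙yz≈y∙xz (suc ℓ) w (suc ℓ * ∣ L′ ∣) ⟩
    w + (suc ℓ + suc ℓ * ∣ L′ ∣) ≤⟨ +-monoˡ-≤ _ (m≤n+m w r) ⟩
    r + w + (suc ℓ + suc ℓ * ∣ L′ ∣) ≡⟨ cong (r + w +_) (sym (*-suc (suc ℓ) ∣ L′ ∣)) ⟩
    r + w + suc ℓ * suc ∣ L′ ∣ ∎)
smaller-boxes {ℓ = ℓ} (inside ∷ L) (r ∷ v) D bd bal | no r≰ℓ
  with refl ← ≤-antisym (bd here) (≰⇒> r≰ℓ)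
  with smaller-boxes L v D (bd ∘ there)
         (+-cancelˡ-≡ (suc ℓ) _ _ (trans (sym (+-assoc (suc ℓ) _ D)) (trans bal (*-suc (suc ℓ) ∣ L ∣))))
... | L′ , L′⊆L , bd′ , D≤ = outside ∷ L′ , out⊆ L′⊆L , (λ { (there i∈L′) → bd′ i∈L′ }) , D≤

-- Full boxes are dropped one at a time until `q` junk cells are available. Each drop adds `ℓ` ≥ 1
-- junk cells, so a fuel `f` covering the shortage suffices, and `D + f ≤ ∣ L ∣` keeps a full box at
-- hand. Just before the last drop fewer than `q` cells were junk, whence the bound `q + ℓ` when
-- anything was dropped.
refill : ∀ {n ℓ} q f (L : Subset n) (v : Vec ℕ n) D → 1 ≤ ℓ → Bounded ℓ L v →
  weight L v + D ≡ ℓ * ∣ L ∣ → D + f ≤ ∣ L ∣ → q ≤ weight (∁ L) v + f →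
  ∃[ L′ ] ∃[ c ] (L′ ⊆ L × ∣ L′ ∣ + c ≡ ∣ L ∣ × c ≤ f × weight L′ v + D ≡ ℓ * ∣ L′ ∣ ×
    q ≤ weight (∁ L′) v × weight (∁ L′) v ≡ weight (∁ L) v + c * ℓ ×
    (c ≡ 0 ⊎ weight (∁ L′) v < q + ℓ))
refill q zero L v D 1≤ℓ bd bal D+f≤ q≤ =
  L , 0 , ⊆-refl , +-identityʳ _ , z≤n , bal , subst (q ≤_) (+-identityʳ _) q≤ , sym (+-identityʳ _) , inj₁ refl
refill {ℓ = ℓ} q (suc f) L v D 1≤ℓ bd bal D+f≤ q≤ with q ≤? weight (∁ L) v
... | yes q≤j =
  L , 0 , ⊆-refl , +-identityʳ _ , z≤n , bal , q≤j , sym (+-identityʳ _) , inj₁ refl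
... | no q≰j
  with drop-full L v D bd bal (≤-trans (≤-trans (s≤s (m≤m+n D f)) (≤-reflexive (sym (+-suc D f)))) D+f≤)
... | L₁ , L₁⊆L , size₁ , bal₁ , junk₁
  with refill q f L₁ v D 1≤ℓ (bd ∘ L₁⊆L) bal₁ D+f≤₁ q≤₁
  where
  D+f≤₁ : D + f ≤ ∣ L₁ ∣
  D+f≤₁ = s≤s⁻¹ (≤-trans (≤-reflexive (sym (+-suc D f))) (≤-trans D+f≤ (≤-reflexive (sym size₁))))
  open ≤-Reasoning
  q≤₁ : q ≤ weight (∁ L₁) v + f
  q≤₁ = begin
    q ≤⟨ q≤ ⟩
    weight (∁ L) v + suc f ≡⟨ +-suc _ f ⟩
    suc (weight (∁ L) v + f) ≤⟨ +-monoˡ-≤ (weight (∁ L) v + f) 1≤ℓ ⟩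
    ℓ + (weight (∁ L) v + f) ≡⟨ sym (+-assoc ℓ _ f) ⟩
    ℓ + weight (∁ L) v + f ≡⟨ cong (_+ f) (sym junk₁) ⟩
    weight (∁ L₁) v + f ∎
... | L′ , c , L′⊆L₁ , size , c≤f , bal′ , q≤j′ , junk , small =
  L′ , suc c , ⊆-trans L′⊆L₁ L₁⊆L , trans (+-suc _ c) (trans (cong suc size) size₁) , s≤s c≤f , bal′ , q≤j′ ,
  junk≡ , inj₂ (small′ small)
  where
  junk≡ : weight (∁ L′) v ≡ weight (∁ L) v + (ℓ + c * ℓ)
  junk≡ = trans junk (trans (cong (_+ c * ℓ) junk₁) (xy∙z≈y∙xz ℓ (weight (∁ L) v) (c * ℓ)))
  small′ : c ≡ 0 ⊎ weight (∁ L′) v < q + ℓ → weight (∁ L′) v < q + ℓ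
  small′ (inj₂ j′<) = j′<
  small′ (inj₁ refl) =
    subst (_< q + ℓ) (sym (trans junk≡ (cong (weight (∁ L) v +_) (+-identityʳ ℓ)))) (+-monoˡ-< ℓ (≰⇒> q≰j))

-- Residues modulo ℓ.

-- Bézout: the iteration j ↦ j − s modulo ℓ reaches a residue below gcd s ℓ ≤ p
-- within a number of steps depending only on s and ℓ.
descend : ∀ s ℓ p → 1 ≤ ℓ → gcd s ℓ ≤ p →
  ∃[ τ ] ((j : ℕ) → j < ℓ → ∃[ t ] ∃[ r ] ∃[ z ] ∃[ w ] (t ≤ τ × r < p × j + z * ℓ ≡ r + t * s + w * ℓ))
descend s ℓ@(suc l) p 1≤ℓ g≤p = ℓ * x , go
  where
  g = gcd s ℓ
  instance
    g≢0 : NonZero g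
    g≢0 = ≢-nonZero (gcd[m,n]≢0 s ℓ (inj₂ λ ()))
  bezout : ∃[ x ] ∃[ z ] ∃[ w ] (g + z * ℓ ≡ x * s + w * ℓ)
  bezout with Bézout.identity (gcd-GCD s ℓ)
  ... | Bézout.+- x y eq = x , y , 0 , trans eq (sym (+-identityʳ _))
  -- Here `g` is congruent to `-x * s`; adding `x * s * ℓ` replaces the coefficient `-x` by the
  -- natural number `x * l`.
  ... | Bézout.-+ x y eq = x * l , x * s , y , (begin
    g + x * s * suc l ≡⟨ e₁ g x s l ⟩
    g + x * s + x * l * s ≡⟨ cong (_+ x * l * s) eq ⟩
    y * suc l + x * l * s ≡⟨ +-comm (y * suc l) _ ⟩
    x * l * s + y * suc l ∎)
    where
    open ≡-Reasoning
    e₁ : ∀ g x s l → g + x * s * suc l ≡ g + x * s + x * l * s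
    e₁ = solve-∀
  x = proj₁ bezout
  z = proj₁ (proj₂ bezout)
  w = proj₁ (proj₂ (proj₂ bezout))
  go : (j : ℕ) → j < ℓ → _
  -- Since `j` is `j % g + a * g` and `g` is congruent to `x * s`, subtracting `s` exactly `a * x`
  -- times leaves `j % g`, which is below `g`. The uniform bound comes from `a ≤ j < ℓ`.
  go j j<ℓ = a * x , j % g , a * z , a * w , *-monoˡ-≤ x (≤-trans (m/n≤m j g) (<⇒≤ j<ℓ)) ,
    <-≤-trans (m%n<n j g) g≤p , (begin
    j + a * z * ℓ ≡⟨ cong (_+ a * z * ℓ) (m≡m%n+[m/n]*n j g) ⟩
    j % g + a * g + a * z * ℓ ≡⟨ e₂ (j % g) a g z ℓ ⟩
    j % g + a * (g + z * ℓ) ≡⟨ cong (λ y → j % g + a * y) (proj₂ (proj₂ (proj₂ bezout))) ⟩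
    j % g + a * (x * s + w * ℓ) ≡⟨ e₃ (j % g) a x s w ℓ ⟩
    j % g + a * x * s + a * w * ℓ ∎)
    where
    open ≡-Reasoning
    a = j / g
    e₂ : ∀ r a g z ℓ → r + a * g + a * z * ℓ ≡ r + a * (g + z * ℓ)
    e₂ = solve-∀
    e₃ : ∀ r a x s w ℓ → r + a * (x * s + w * ℓ) ≡ r + a * x * s + a * w * ℓ
    e₃ = solve-∀

-- Free cells per box, and how a move changes them.

-- Boxes are encoded by a labelling `β` of the cells, so they are disjoint by construction and each
-- claimed cell lowers exactly one entry.
residuals : ∀ {m n} → Vec (Fin n) m → Position m → Vec ℕ n
residuals {n = n} [] [] = replicate n 0
residuals (i ∷ β) (unclaimed  ∷ pos) = updateAt (residuals β pos) i suc
residuals (i ∷ β) (byAvoider  ∷ pos) = residuals β pos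
residuals (i ∷ β) (byEnforcer ∷ pos) = residuals β pos

AllFree : ∀ {m} → Subset m → Position m → Set
AllFree S pos = ∀ x → x ∈ S → lookup pos x ≡ unclaimed

AllFree-tail : ∀ {m s c} {S : Subset m} {pos} → AllFree (s ∷ S) (c ∷ pos) → AllFree S pos
AllFree-tail free x = free (suc x) ∘ there

lookup-claim-∈ : ∀ {m} o (S : Subset m) pos {x} → x ∈ S → lookup (claim o S pos) x ≡ o
lookup-claim-∈ o (_ ∷ S) (_ ∷ pos) here        = refl
lookup-claim-∈ o (_ ∷ S) (_ ∷ pos) (there x∈S) = lookup-claim-∈ o S pos x∈S

lookup-claim-∉ : ∀ {m} o (S : Subset m) pos {x} → x ∉ S → lookup (claim o S pos) x ≡ lookup pos x
lookup-claim-∉ o (inside  ∷ S) (_ ∷ pos) {zero}  x∉S = contradiction here x∉S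
lookup-claim-∉ o (outside ∷ S) (_ ∷ pos) {zero}  x∉S = refl
lookup-claim-∉ o (_       ∷ S) (_ ∷ pos) {suc x} x∉S = lookup-claim-∉ o S pos (x∉S ∘ there)

claim-keeps : ∀ {m o o′} (S : Subset m) pos {x} → AllFree S pos → o ≢ unclaimed →
  lookup pos x ≡ o → lookup (claim o′ S pos) x ≡ o
claim-keeps {o′ = o′} S pos {x} free o≢ eq with x ∈? S
... | yes x∈S = contradiction (trans (sym eq) (free x x∈S)) o≢
... | no  x∉S = trans (lookup-claim-∉ o′ S pos x∉S) eq

freeCount-claim : ∀ {m o} (S : Subset m) pos → o ≢ unclaimed → AllFree S pos →
  freeCount (claim o S pos) + ∣ S ∣ ≡ freeCount pos
freeCount-claim [] [] o≢ free = refl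
freeCount-claim {o = o} (inside ∷ S) (c ∷ pos) o≢ free with refl ← free zero here | o
... | unclaimed  = contradiction refl o≢
... | byAvoider  = trans (+-suc _ _) (cong suc (freeCount-claim S pos (λ ()) (AllFree-tail free)))
... | byEnforcer = trans (+-suc _ _) (cong suc (freeCount-claim S pos (λ ()) (AllFree-tail free)))
freeCount-claim (outside ∷ S) (unclaimed  ∷ pos) o≢ free = cong suc (freeCount-claim S pos o≢ (AllFree-tail free))
freeCount-claim (outside ∷ S) (byAvoider  ∷ pos) o≢ free = freeCount-claim S pos o≢ (AllFree-tail free)
freeCount-claim (outside ∷ S) (byEnforcer ∷ pos) o≢ free = freeCount-claim S pos o≢ (AllFree-tail free)

≼-updateAt-suc : ∀ {n} (i : Fin n) {u v} → u ≼ v → u ≼ updateAt v i suc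
≼-updateAt-suc zero    (r≤s ∷ u≼v) = m≤n⇒m≤1+n r≤s ∷ u≼v
≼-updateAt-suc (suc i) (r≤s ∷ u≼v) = r≤s ∷ ≼-updateAt-suc i u≼v

updateAt-suc-mono : ∀ {n} (i : Fin n) {u v} → u ≼ v → updateAt u i suc ≼ updateAt v i suc
updateAt-suc-mono zero    (r≤s ∷ u≼v) = s≤s r≤s ∷ u≼v
updateAt-suc-mono (suc i) (r≤s ∷ u≼v) = r≤s ∷ updateAt-suc-mono i u≼v

residuals-claim : ∀ {m n o} (β : Vec (Fin n) m) S pos → o ≢ unclaimed → AllFree S pos →
  residuals β (claim o S pos) ≼ residuals β pos
residuals-claim [] [] [] o≢ free = Pointwise.refl ≤-refl
residuals-claim {o = o} (i ∷ β) (inside ∷ S) (c ∷ pos) o≢ free with refl ← free zero here | o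
... | unclaimed  = contradiction refl o≢
... | byAvoider  = ≼-updateAt-suc i (residuals-claim β S pos (λ ()) (AllFree-tail free))
... | byEnforcer = ≼-updateAt-suc i (residuals-claim β S pos (λ ()) (AllFree-tail free))
residuals-claim (i ∷ β) (outside ∷ S) (unclaimed  ∷ pos) o≢ free = updateAt-suc-mono i (residuals-claim β S pos o≢ (AllFree-tail free))
residuals-claim (i ∷ β) (outside ∷ S) (byAvoider  ∷ pos) o≢ free = residuals-claim β S pos o≢ (AllFree-tail free)
residuals-claim (i ∷ β) (outside ∷ S) (byEnforcer ∷ pos) o≢ free = residuals-claim β S pos o≢ (AllFree-tail free)

weight-zeros : ∀ {n} (L : Subset n) → weight L (replicate n 0) ≡ 0
weight-zeros []            = refl
weight-zeros (inside  ∷ L) = weight-zeros L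
weight-zeros (outside ∷ L) = weight-zeros L

freeCount-split : ∀ {m n} (β : Vec (Fin n) m) (L : Subset n) pos →
  freeCount pos ≡ weight L (residuals β pos) + weight (∁ L) (residuals β pos)
freeCount-split [] L [] = sym (cong₂ _+_ (weight-zeros L) (weight-zeros (∁ L)))
freeCount-split (i ∷ β) L (unclaimed ∷ pos) with i ∈? L
... | yes i∈L = trans (cong suc (freeCount-split β L pos))
  (sym (cong₂ _+_ (weight-updateAt-∈ _ i∈L) (weight-updateAt-∉ _ (x∈p⇒x∉∁p i∈L))))
... | no i∉L = trans (cong suc (freeCount-split β L pos)) (trans (sym (+-suc _ _))
  (sym (cong₂ _+_ (weight-updateAt-∉ _ i∉L) (weight-updateAt-∈ _ (x∉p⇒x∈∁p i∉L)))))
freeCount-split (i ∷ β) L (byAvoider  ∷ pos) = freeCount-split β L pos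
freeCount-split (i ∷ β) L (byEnforcer ∷ pos) = freeCount-split β L pos

pick-junk : ∀ {m n} (β : Vec (Fin n) m) (L : Subset n) pos q → q ≤ weight (∁ L) (residuals β pos) →
  ∃[ S ] (AllFree S pos × ∣ S ∣ ≡ q × (∀ {x} → x ∈ S → lookup β x ∉ L))
pick-junk {n = n} β L = go β
  where
  JunkMove : ∀ {m} → Vec (Fin n) m → Position m → ℕ → Set
  JunkMove β pos q = ∃[ S ] (AllFree S pos × ∣ S ∣ ≡ q × (∀ {x} → x ∈ S → lookup β x ∉ L))

  skip : ∀ {m i c q} {β : Vec (Fin n) m} {pos} → JunkMove β pos q → JunkMove (i ∷ β) (c ∷ pos) q
  skip (S , free , size , off) =
    outside ∷ S , (λ { (suc x) (there x∈S) → free x x∈S }) , size , (λ { (there x∈S) → off x∈S })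

  go : ∀ {m} (β : Vec (Fin n) m) pos q → q ≤ weight (∁ L) (residuals β pos) → JunkMove β pos q
  go []      []                 zero    q≤ = [] , (λ _ ()) , refl , (λ ())
  go []      []                 (suc q) q≤ = contradiction (≤-trans q≤ (≤-reflexive (weight-zeros (∁ L)))) λ ()
  go (i ∷ β) (byAvoider  ∷ pos) q       q≤ = skip (go β pos q q≤)
  go (i ∷ β) (byEnforcer ∷ pos) q       q≤ = skip (go β pos q q≤)
  go (i ∷ β) (unclaimed  ∷ pos) zero    q≤ = skip (go β pos 0 z≤n)
  go (i ∷ β) (unclaimed  ∷ pos) (suc q) q≤ with i ∈? L
  ... | yes i∈L = skip (go β pos (suc q) (≤-trans q≤ (≤-reflexive (weight-updateAt-∉ _ (x∈p⇒x∉∁p i∈L)))))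
  ... | no  i∉L
    with go β pos q (s≤s⁻¹ (≤-trans q≤ (≤-reflexive (weight-updateAt-∈ _ (x∉p⇒x∈∁p i∉L)))))
  ...   | S , free , size , off =
    inside ∷ S , (λ { zero here → refl ; (suc x) (there x∈S) → free x x∈S }) , cong suc size ,
    (λ { here → i∉L ; (there x∈S) → off x∈S })

pick-free : ∀ {m} (pos : Position m) r → r ≤ freeCount pos → ∃[ S ] (AllFree S pos × ∣ S ∣ ≡ r)
pick-free {m} pos r r≤ =
  -- With a single label and no live box, every free cell counts as junk.
  let S , free , size , _ = pick-junk (replicate m (zero {0})) ⊥ pos r (≤-trans r≤ (≤-reflexive split))
  in S , free , size
  where
  v = residuals (replicate m (zero {0})) pos
  split : freeCount pos ≡ weight (∁ ⊥) v
  split = trans (freeCount-split (replicate m zero) ⊥ pos) (cong (_+ weight (∁ ⊥) v) (weight-⊥ v))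

weight-claim-junk : ∀ {m n o} (β : Vec (Fin n) m) (L : Subset n) S pos → o ≢ unclaimed → AllFree S pos →
  (∀ {x} → x ∈ S → lookup β x ∉ L) →
  weight L (residuals β (claim o S pos)) ≡ weight L (residuals β pos)
weight-claim-junk [] L [] [] o≢ free off = refl
weight-claim-junk {o = o} (i ∷ β) L (inside ∷ S) (c ∷ pos) o≢ free off with refl ← free zero here | o
... | unclaimed  = contradiction refl o≢
... | byAvoider  = trans (weight-claim-junk β L S pos (λ ()) (AllFree-tail free) (off ∘ there)) (sym (weight-updateAt-∉ _ (off here)))
... | byEnforcer = trans (weight-claim-junk β L S pos (λ ()) (AllFree-tail free) (off ∘ there)) (sym (weight-updateAt-∉ _ (off here)))
weight-claim-junk (i ∷ β) L (outside ∷ S) (unclaimed ∷ pos) o≢ free off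
  with ih ← weight-claim-junk β L S pos o≢ (AllFree-tail free) (off ∘ there) | i ∈? L
... | yes i∈L = trans (weight-updateAt-∈ _ i∈L) (trans (cong suc ih) (sym (weight-updateAt-∈ _ i∈L)))
... | no  i∉L = trans (weight-updateAt-∉ _ i∉L) (trans ih (sym (weight-updateAt-∉ _ i∉L)))
weight-claim-junk (i ∷ β) L (outside ∷ S) (byAvoider  ∷ pos) o≢ free off = weight-claim-junk β L S pos o≢ (AllFree-tail free) (off ∘ there)
weight-claim-junk (i ∷ β) L (outside ∷ S) (byEnforcer ∷ pos) o≢ free off = weight-claim-junk β L S pos o≢ (AllFree-tail free) (off ∘ there)

residual≡0 : ∀ {m n} (β : Vec (Fin n) m) pos {i x} → lookup (residuals β pos) i ≡ 0 →
  lookup β x ≡ i → lookup pos x ≢ unclaimed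
residual≡0 (i ∷ β) (unclaimed ∷ pos) {x = zero} r≡0 refl refl =
  contradiction (trans (sym (lookup∘updateAt i (residuals β pos))) r≡0) λ ()
residual≡0 (j ∷ β) (unclaimed ∷ pos) {i} {suc x} r≡0 eq = residual≡0 β pos
  (n≤0⇒n≡0 (≤-trans (Pointwise.lookup (≼-updateAt-suc j (Pointwise.refl ≤-refl {x = residuals β pos})) i) (≤-reflexive r≡0))) eq
residual≡0 (j ∷ β) (byAvoider ∷ pos) {x = suc x} r≡0 eq = residual≡0 β pos r≡0 eq
residual≡0 (j ∷ β) (byEnforcer ∷ pos) {x = suc x} r≡0 eq = residual≡0 β pos r≡0 eq
residual≡0 (j ∷ β) (byAvoider ∷ pos) {x = zero} r≡0 eq ()
residual≡0 (j ∷ β) (byEnforcer ∷ pos) {x = zero} r≡0 eq ()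

-- Enforcer's strategy on a labelled board.

Safe : ∀ {m n} → Vec (Fin n) m → Subset n → Position m → Set
Safe β L pos = ∀ x → lookup β x ∈ L → lookup pos x ≢ byEnforcer

safe-byAvoider : ∀ {m n} {β : Vec (Fin n) m} {L} S pos → Safe β L pos → Safe β L (claim byAvoider S pos)
safe-byAvoider S pos safe x βx∈L eq with x ∈? S
... | yes x∈S = contradiction (trans (sym (lookup-claim-∈ byAvoider S pos x∈S)) eq) λ ()
... | no  x∉S = safe x βx∈L (trans (sym (lookup-claim-∉ byAvoider S pos x∉S)) eq)

safe-byEnforcer : ∀ {m n} {β : Vec (Fin n) m} {L} S pos → (∀ {x} → x ∈ S → lookup β x ∉ L) →
  Safe β L pos → Safe β L (claim byEnforcer S pos)
safe-byEnforcer S pos off safe x βx∈L eq with x ∈? S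
... | yes x∈S = off x∈S βx∈L
... | no  x∉S = safe x βx∈L (trans (sym (lookup-claim-∉ byEnforcer S pos x∉S)) eq)

-- Live boxes that suffice when `D` is within `e` of `target`. The base keeps `p` free cells and `q`
-- full boxes available while `D < target`. Each Enforcer turn drops at most `q` boxes; between two
-- increases of `D` he pays for his first reply, for the turn that ends the initial junk, and for at
-- most `τ` turns of the residue cycle. It involves no board, so that the final threshold is
-- uniform.
boxBudget : (p q τ target e : ℕ) → ℕ
boxBudget p q τ target zero    = target + (p + q)
boxBudget p q τ target (suc e) = boxBudget p q τ target e + (τ * q + q + q)

module Play {m n} (p q : ℕ) (1≤p : 1 ≤ p) (1≤q : 1 ≤ q)
  (β : Vec (Fin n) m) (F : Fin n → Subset m) (F⊆β : ∀ i x → x ∈ F i → lookup β x ≡ i) where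

  Wins : Player → Position m → Set
  Wins = EnforcerWinsFrom p q F

  res : Position m → Vec ℕ n
  res = residuals β

  -- The outcome is declared only on a full board, so the remaining moves are played out
  -- arbitrarily. Claimed cells never change owner, and `f` bounds the free cells, of which every
  -- move takes at least one.
  avoider-owns-box : ∀ {i} f pl pos → freeCount pos ≤ f → (∀ x → lookup β x ≡ i → lookup pos x ≡ byAvoider) →
    Wins pl pos
  avoider-owns-box {i} f pl pos free≤f own with freeCount pos ≟ 0
  ... | yes over = gameOver over (i , λ x x∈F → own x (F⊆β i x x∈F))
  avoider-owns-box zero pl pos free≤f own | no ongoing = contradiction (n≤0⇒n≡0 free≤f) ongoing
  avoider-owns-box {i} (suc f) pl pos free≤f own | no ongoing = move pl
    where
    shrinks : ∀ {o r} S → o ≢ unclaimed → 1 ≤ r → LegalMove r pos S → freeCount (claim o S pos) ≤ f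
    shrinks {o} {r} S o≢ 1≤r (free , size) = s≤s⁻¹ (begin-strict
      freeCount (claim o S pos)         <⟨ m<m+n _ (subst (1 ≤_) (sym size) (⊓-glb 1≤r (n≢0⇒n>0 ongoing))) ⟩
      freeCount (claim o S pos) + ∣ S ∣ ≡⟨ freeCount-claim S pos o≢ free ⟩
      freeCount pos                     ≤⟨ free≤f ⟩
      suc f                             ∎)
      where open ≤-Reasoning
    move : ∀ pl → Wins pl pos
    move Avoider = avoiderMove ongoing λ S legal →
      avoider-owns-box f Enforcer _ (shrinks S (λ ()) 1≤p legal)
        (λ x βx → claim-keeps S pos (proj₁ legal) (λ ()) (own x βx))
    move Enforcer with pick-free pos (q ⊓ freeCount pos) (m⊓n≤n q _)
    ... | S , legal = enforcerMove ongoing S legal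
      (avoider-owns-box f Avoider _ (shrinks S (λ ()) 1≤q legal)
        (λ x βx → claim-keeps S pos (proj₁ legal) (λ ()) (own x βx)))

  empty-box-wins : ∀ {L i} pl pos → Safe β L pos → i ∈ L → lookup (res pos) i ≡ 0 → Wins pl pos
  empty-box-wins {L} {i} pl pos safe i∈L r≡0 = avoider-owns-box (freeCount pos) pl pos ≤-refl own
    where
    own : ∀ x → lookup β x ≡ i → lookup pos x ≡ byAvoider
    own x βx≡i with lookup pos x in eq
    ... | unclaimed  = contradiction eq (residual≡0 β pos r≡0 βx≡i)
    ... | byAvoider  = refl
    ... | byEnforcer = contradiction eq (safe x (subst (_∈ L) (sym βx≡i) i∈L))

  -- The bound `p ≤ freeCount pos` excludes a shortened last move, so that Avoider claims exactly
  -- `p` cells.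
  avoider-step : ∀ {L} pos → Safe β L pos → p ≤ freeCount pos →
    (∀ pos′ → Safe β L pos′ → res pos′ ≼ res pos → freeCount pos′ + p ≡ freeCount pos → Wins Enforcer pos′) →
    Wins Avoider pos
  avoider-step {L} pos safe p≤free next = avoiderMove (>⇒≢ (≤-trans 1≤p p≤free)) λ S (free , size) →
    next _ (safe-byAvoider {β = β} {L} S pos safe) (residuals-claim β S pos (λ ()) free)
      (trans (cong (freeCount (claim byAvoider S pos) +_) (sym (trans size (m≤n⇒m⊓n≡m p≤free)))) (freeCount-claim S pos (λ ()) free))

  enforcer-step : ∀ {L} pos → Safe β L pos → q ≤ weight (∁ L) (res pos) →
    (∀ pos′ → Safe β L pos′ → res pos′ ≼ res pos → weight L (res pos′) ≡ weight L (res pos) →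
      weight (∁ L) (res pos′) + q ≡ weight (∁ L) (res pos) → Wins Avoider pos′) →
    Wins Enforcer pos
  enforcer-step {L} pos safe q≤junk next with pick-junk β L pos q q≤junk
  ... | S , free , size , off = enforcerMove (>⇒≢ (≤-trans 1≤q q≤free)) S (free , trans size (sym (m≤n⇒m⊓n≡m q≤free)))
    (next _ (safe-byEnforcer {β = β} {L} S pos off safe) (residuals-claim β S pos (λ ()) free) same junk)
    where
    q≤free : q ≤ freeCount pos
    q≤free = ≤-trans q≤junk (≤-trans (m≤n+m _ (weight L (res pos))) (≤-reflexive (sym (freeCount-split β L pos))))
    pos′ = claim byEnforcer S pos
    same : weight L (res pos′) ≡ weight L (res pos)
    same = weight-claim-junk β L S pos (λ ()) free off
    open ≡-Reasoning
    junk : weight (∁ L) (res pos′) + q ≡ weight (∁ L) (res pos)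
    junk = +-cancelˡ-≡ (weight L (res pos)) _ _ (begin
      weight L (res pos) + (weight (∁ L) (res pos′) + q)  ≡⟨ sym (+-assoc (weight L (res pos)) _ q) ⟩
      weight L (res pos) + weight (∁ L) (res pos′) + q    ≡⟨ cong (λ w → w + weight (∁ L) (res pos′) + q) (sym same) ⟩
      weight L (res pos′) + weight (∁ L) (res pos′) + q   ≡⟨ cong₂ _+_ (sym (freeCount-split β L pos′)) (sym size) ⟩
      freeCount pos′ + ∣ S ∣                              ≡⟨ freeCount-claim S pos (λ ()) free ⟩
      freeCount pos                                       ≡⟨ freeCount-split β L pos ⟩
      weight L (res pos) + weight (∁ L) (res pos)         ∎)

  -- All positions and both players to move are included, because the induction on `ℓ` enters this
  -- statement in the middle of a game.
  WinningAt : ℕ → ℕ → Set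
  WinningAt ℓ N = ∀ pl pos L → Safe β L pos → Bounded ℓ L (res pos) → N ≤ ∣ L ∣ → Wins pl pos

  winningAt-0 : WinningAt 0 1
  winningAt-0 pl pos L safe bd 1≤L with nonempty L 1≤L
    where
    nonempty : ∀ {n} (L : Subset n) → 1 ≤ ∣ L ∣ → ∃[ i ] i ∈ L
    nonempty (inside  ∷ L) 1≤L = zero , here
    nonempty (outside ∷ L) 1≤L with nonempty L 1≤L
    ... | i , i∈L = suc i , there i∈L
  ... | i , i∈L = empty-box-wins pl pos safe i∈L (n≤0⇒n≡0 (bd i∈L))

  -- The step from box size `l` to `suc l`.

  module Step (l M τ : ℕ) (ih : WinningAt l M)
    (timing : (j : ℕ) → j < suc l → ∃[ t ] ∃[ r ] ∃[ z ] ∃[ w ]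
       (t ≤ τ × r < p × j + z * suc l ≡ r + t * (p + q) + w * suc l)) where

    ℓ target : ℕ
    ℓ = suc l
    target = ℓ * M

    budget : ℕ → ℕ
    budget = boxBudget p q τ target

    target+p+q≤budget : ∀ e → target + (p + q) ≤ budget e
    target+p+q≤budget zero    = ≤-refl
    target+p+q≤budget (suc e) = ≤-trans (target+p+q≤budget e) (m≤m+n _ _)

    -- `balance` defines the deficit `D` additively, which avoids truncated subtraction.
    record Threat (L : Subset n) (pos : Position m) (D : ℕ) : Set where
      field
        safe    : Safe β L pos
        bounded : Bounded ℓ L (res pos)
        balance : weight L (res pos) + D ≡ ℓ * ∣ L ∣
    open Threat

    junk : Subset n → Position m → ℕ
    junk L pos = weight (∁ L) (res pos)

    target-reached : ∀ {L D} pl pos → Threat L pos D → target ≤ D → Wins pl pos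
    target-reached {L} {D} pl pos th target≤D with smaller-boxes L (res pos) D (bounded th) (balance th)
    ... | L′ , L′⊆L , bd′ , D≤ =
      ih pl pos L′ (λ x → safe th x ∘ L′⊆L) bd′ (*-cancelˡ-≤ ℓ (≤-trans target≤D D≤))

    -- Refilling followed by a move of `q` junk cells. The live boxes lose no cell, so `D` is
    -- unchanged, and the bound `q + ℓ` from `refill` becomes `ℓ` once the `q` cells are gone.
    enforcer-reply : ∀ {L D} pos → Threat L pos D → D < target → target + q ≤ ∣ L ∣ →
      (∀ pos′ L′ c → Threat L′ pos′ D → ∣ L′ ∣ + c ≡ ∣ L ∣ → c ≤ q →
        junk L′ pos′ + q ≡ junk L pos + c * ℓ → c ≡ 0 ⊎ junk L′ pos′ < ℓ → Wins Avoider pos′) →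
      Wins Enforcer pos
    enforcer-reply {L} {D} pos th D<target size next
      with refill q q L (res pos) D (s≤s z≤n) (bounded th) (balance th)
             (≤-trans (+-monoˡ-≤ q (<⇒≤ D<target)) size) (m≤n+m q _)
    ... | L′ , c , L′⊆L , size′ , c≤q , bal′ , q≤junk , junk≡ , small =
      enforcer-step {L′} pos (λ x → safe th x ∘ L′⊆L) q≤junk λ pos′ safe′ pos′≼pos same junk′ →
        next pos′ L′ c
          (record { safe = safe′ ; bounded = λ {i} i∈L′ → ≤-trans (Pointwise.lookup pos′≼pos i) (bounded th (L′⊆L i∈L′))
                  ; balance = trans (cong (_+ D) same) bal′ })
          size′ c≤q (trans junk′ junk≡)
          (Sum.map₂ (λ small′ → +-cancelʳ-< q _ _ (subst₂ _<_ (sym junk′) (+-comm q ℓ) small′)) small)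

    -- The induction variable `e` bounds how far `D` still has to rise.
    Forced : ℕ → Set
    Forced e = ∀ pos L D → Threat L pos D → target ≤ D + e → budget e ≤ ∣ L ∣ → Wins Enforcer pos

    -- Either Avoider takes a cell of a live box, so that `D` rises and the claim for `e` applies,
    -- or all his `p` cells are junk. In the second case Enforcer replies and play goes on through
    -- `next`, with the junk lowered by `p + q` modulo `ℓ`.
    round : ∀ e → Forced e → ∀ {L D} pos → Threat L pos D → target ≤ D + suc e → budget e ≤ ∣ L ∣ →
      (p ≤ junk L pos → ∀ pos′ L′ c → Threat L′ pos′ D → ∣ L′ ∣ + c ≡ ∣ L ∣ → c ≤ q →
        junk L′ pos′ + (p + q) ≡ junk L pos + c * ℓ → c ≡ 0 ⊎ junk L′ pos′ < ℓ → Wins Avoider pos′) →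
      Wins Avoider pos
    round e forced {L} {D} pos th need size next with target ≤? D
    ... | yes target≤D = target-reached Avoider pos th target≤D
    ... | no target≰D = avoider-step pos (safe th) p≤free reply
      where
      size₀ : target + (p + q) ≤ ∣ L ∣
      size₀ = ≤-trans (target+p+q≤budget e) size

      p≤free : p ≤ freeCount pos
      p≤free = +-cancelˡ-≤ D _ _ (begin
        D + p                               ≤⟨ +-mono-≤ (<⇒≤ (≰⇒> target≰D)) (m≤m+n p q) ⟩
        target + (p + q)                    ≤⟨ size₀ ⟩
        ∣ L ∣                               ≤⟨ m≤m+n ∣ L ∣ (l * ∣ L ∣) ⟩
        ℓ * ∣ L ∣                           ≡⟨ sym (balance th) ⟩
        weight L (res pos) + D              ≡⟨ +-comm _ D ⟩
        D + weight L (res pos)              ≤⟨ +-monoʳ-≤ D (m≤m+n _ (junk L pos)) ⟩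
        D + (weight L (res pos) + junk L pos) ≡⟨ cong (D +_) (sym (freeCount-split β L pos)) ⟩
        D + freeCount pos                   ∎)
        where open ≤-Reasoning

      reply : ∀ pos₁ → Safe β L pos₁ → res pos₁ ≼ res pos → freeCount pos₁ + p ≡ freeCount pos → Wins Enforcer pos₁
      reply pos₁ safe₁ pos₁≼pos free₁ with m≤n⇒m<n∨m≡n (weight-mono L pos₁≼pos)
      ... | inj₁ eaten = forced pos₁ L (D + δ) (record { safe = safe₁ ; bounded = bounded₁ ; balance = balance₁ }) need₁ size
        where
        δ = weight L (res pos) ∸ weight L (res pos₁)
        bounded₁ : Bounded ℓ L (res pos₁)
        bounded₁ {i} i∈L = ≤-trans (Pointwise.lookup pos₁≼pos i) (bounded th i∈L)
        balance₁ : weight L (res pos₁) + (D + δ) ≡ ℓ * ∣ L ∣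
        balance₁ = trans (x∙yz≈xz∙y (weight L (res pos₁)) D δ)
          (trans (cong (_+ D) (m+[n∸m]≡n (<⇒≤ eaten))) (balance th))
        need₁ : target ≤ D + δ + e
        need₁ = ≤-trans need (≤-trans (+-monoʳ-≤ D (+-monoˡ-≤ e (m<n⇒0<n∸m eaten))) (≤-reflexive (sym (+-assoc D δ e))))
      ... | inj₂ same = enforcer-reply pos₁ th₁ (≰⇒> target≰D) (≤-trans (+-monoʳ-≤ target (m≤n+m q p)) size₀)
        λ pos₂ L′ c th₂ size₂ c≤q junk₂ small →
          next (≤-trans (m≤n+m p _) (≤-reflexive junk₁)) pos₂ L′ c th₂ size₂ c≤q (two-moves junk₂) small
        where
        th₁ : Threat L pos₁ D
        th₁ = record
          { safe = safe₁
          ; bounded = λ {i} i∈L → ≤-trans (Pointwise.lookup pos₁≼pos i) (bounded th i∈L)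
          ; balance = trans (cong (_+ D) same) (balance th) }
        open ≡-Reasoning
        junk₁ : junk L pos₁ + p ≡ junk L pos
        junk₁ = +-cancelˡ-≡ (weight L (res pos)) _ _ (begin
          weight L (res pos) + (junk L pos₁ + p)   ≡⟨ sym (+-assoc (weight L (res pos)) _ p) ⟩
          weight L (res pos) + junk L pos₁ + p     ≡⟨ cong (λ x → x + junk L pos₁ + p) (sym same) ⟩
          weight L (res pos₁) + junk L pos₁ + p    ≡⟨ cong (_+ p) (sym (freeCount-split β L pos₁)) ⟩
          freeCount pos₁ + p                       ≡⟨ free₁ ⟩
          freeCount pos                            ≡⟨ freeCount-split β L pos ⟩
          weight L (res pos) + junk L pos          ∎)
        two-moves : ∀ {a c} → a + q ≡ junk L pos₁ + c → a + (p + q) ≡ junk L pos + c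
        two-moves {a} {c} eq = begin
          a + (p + q)           ≡⟨ x∙yz≈xz∙y a p q ⟩
          a + q + p             ≡⟨ cong (_+ p) eq ⟩
          junk L pos₁ + c + p   ≡⟨ xy∙z≈xz∙y (junk L pos₁) c p ⟩
          junk L pos₁ + p + c   ≡⟨ cong (_+ c) junk₁ ⟩
          junk L pos + c        ∎

    spend : ∀ a x {u u′ c} → a + (x + q) ≤ u → u′ + c ≡ u → c ≤ q → a + x ≤ u′
    spend a x {u} {u′} {c} a+x+q≤u u′+c≡u c≤q = +-cancelʳ-≤ q _ _ (begin
      a + x + q     ≡⟨ +-assoc a x q ⟩
      a + (x + q)   ≤⟨ a+x+q≤u ⟩
      u             ≡⟨ sym u′+c≡u ⟩
      u′ + c        ≤⟨ +-monoʳ-≤ u′ c≤q ⟩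
      u′ + q        ∎)
      where open ≤-Reasoning

    -- The number `t` counts the rounds left before the junk falls to at most `r < p`; at that point
    -- Avoider lacks `p` junk cells and must enter a live box.
    cycle : ∀ e → Forced e → ∀ t r z w {L D} pos → Threat L pos D → target ≤ D + suc e →
      budget e + t * q ≤ ∣ L ∣ → junk L pos < ℓ → r < p →
      junk L pos + z * ℓ ≡ r + t * (p + q) + w * ℓ → Wins Avoider pos
    cycle e forced zero r z w {L} pos th need size j<ℓ r<p eq =
      round e forced pos th need (≤-trans (m≤m+n _ _) size) λ p≤j → contradiction p≤j (<⇒≱ j<p)
      where
      j = junk L pos
      eq′ : j + z * ℓ ≡ r + w * ℓ
      eq′ = trans eq (cong (_+ w * ℓ) (+-identityʳ r))
      -- As `j < ℓ`, the equation forces `w ≤ z`, and cancelling multiples of `ℓ` gives `j ≤ r`.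
      w≤z : w ≤ z
      w≤z = s≤s⁻¹ (*-cancelʳ-< ℓ w (suc z) (begin-strict
        w * ℓ       ≤⟨ m≤n+m _ r ⟩
        r + w * ℓ   ≡⟨ sym eq′ ⟩
        j + z * ℓ   <⟨ +-monoˡ-< (z * ℓ) j<ℓ ⟩
        ℓ + z * ℓ   ∎))
        where open ≤-Reasoning
      j<p : j < p
      j<p = ≤-<-trans (+-cancelʳ-≤ (z * ℓ) j r (≤-trans (≤-reflexive eq′) (+-monoʳ-≤ r (*-monoˡ-≤ ℓ w≤z)))) r<p
    cycle e forced (suc t) r z w {L} pos th need size j<ℓ r<p eq =
      round e forced pos th need (≤-trans (m≤m+n _ _) size) λ p≤j pos′ L′ c th′ size′ c≤q junk′ small →
        -- The `c` dropped boxes add `c * ℓ` to the junk, which `w` absorbs.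
        cycle e forced t r z (w + c) pos′ th′ need
          (spend (budget e) (t * q) (subst (λ x → budget e + x ≤ ∣ L ∣) (+-comm q (t * q)) size) size′ c≤q)
          (still-small {c = c} junk′ small) r<p (congruent {c = c} junk′)
      where
      j = junk L pos
      still-small : ∀ {j′ c} → j′ + (p + q) ≡ j + c * ℓ → c ≡ 0 ⊎ j′ < ℓ → j′ < ℓ
      still-small eq₁ (inj₂ j′<ℓ) = j′<ℓ
      still-small {j′} eq₁ (inj₁ refl) = ≤-<-trans (m≤m+n j′ (p + q)) (subst (_< ℓ) (sym (trans eq₁ (+-identityʳ j))) j<ℓ)
      congruent : ∀ {j′ c} → j′ + (p + q) ≡ j + c * ℓ → j′ + z * ℓ ≡ r + t * (p + q) + (w + c) * ℓ
      congruent {j′} {c} eq₁ = +-cancelʳ-≡ (p + q) _ _ (begin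
        j′ + z * ℓ + (p + q)                      ≡⟨ xy∙z≈xz∙y j′ (z * ℓ) (p + q) ⟩
        j′ + (p + q) + z * ℓ                      ≡⟨ cong (_+ z * ℓ) eq₁ ⟩
        j + c * ℓ + z * ℓ                         ≡⟨ xy∙z≈xz∙y j (c * ℓ) (z * ℓ) ⟩
        j + z * ℓ + c * ℓ                         ≡⟨ cong (_+ c * ℓ) eq ⟩
        r + (p + q + t * (p + q)) + w * ℓ + c * ℓ ≡⟨ e₂ r (p + q) (t * (p + q)) w c ℓ ⟩
        r + t * (p + q) + (w + c) * ℓ + (p + q)   ∎)
        where
        open ≡-Reasoning
        e₂ : ∀ r s ts w c ℓ → r + (s + ts) + w * ℓ + c * ℓ ≡ r + ts + (w + c) * ℓ + s
        e₂ = solve-∀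

    small-junk : ∀ e → Forced e → ∀ {L D} pos → Threat L pos D → target ≤ D + suc e →
      budget e + τ * q ≤ ∣ L ∣ → junk L pos < ℓ → Wins Avoider pos
    small-junk e forced {L} pos th need size j<ℓ with timing (junk L pos) j<ℓ
    ... | t , r , z , w , t≤τ , r<p , eq =
      cycle e forced t r z w pos th need (≤-trans (+-monoʳ-≤ (budget e) (*-monoˡ-≤ q t≤τ)) size) j<ℓ r<p eq

    -- As long as Enforcer drops no box, each round lowers the junk by `p + q` and costs nothing, so
    -- `f` decreases. The first drop costs at most `q` boxes and leaves fewer than `ℓ` junk cells.
    any-junk : ∀ e → Forced e → ∀ f {L D} pos → junk L pos ≤ f → Threat L pos D → target ≤ D + suc e →
      budget e + (τ * q + q) ≤ ∣ L ∣ → Wins Avoider pos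
    any-junk e forced f {L} {D} pos j≤f th need size with junk L pos <? ℓ
    ... | yes j<ℓ = small-junk e forced pos th need (≤-trans (+-monoʳ-≤ (budget e) (m≤m+n _ q)) size) j<ℓ
    any-junk e forced zero pos j≤f th need size | no j≮ℓ = contradiction (s≤s (≤-trans j≤f z≤n)) j≮ℓ
    any-junk e forced (suc f) {L} pos j≤f th need size | no j≮ℓ =
      round e forced pos th need (≤-trans (m≤m+n _ _) size) continue
      where
      continue : p ≤ junk L pos → ∀ pos′ L′ c → Threat L′ pos′ _ → ∣ L′ ∣ + c ≡ ∣ L ∣ → c ≤ q →
        junk L′ pos′ + (p + q) ≡ junk L pos + c * ℓ → c ≡ 0 ⊎ junk L′ pos′ < ℓ → Wins Avoider pos′
      continue _ pos′ L′ c th′ size′ c≤q junk′ (inj₂ j′<ℓ) =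
        small-junk e forced pos′ th′ need (spend (budget e) (τ * q) size size′ c≤q) j′<ℓ
      continue _ pos′ L′ c th′ size′ c≤q junk′ (inj₁ refl) =
        any-junk e forced f pos′ (s≤s⁻¹ (<-≤-trans j′<j j≤f)) th′ need
          (subst (budget e + (τ * q + q) ≤_) (sym (trans (sym (+-identityʳ ∣ L′ ∣)) size′)) size)
        where
        j′<j : junk L′ pos′ < junk L pos
        j′<j = subst (junk L′ pos′ <_) (trans junk′ (+-identityʳ _)) (m<m+n _ (≤-trans 1≤p (m≤m+n p q)))

    forced : ∀ e → Forced e
    forced zero    pos L D th need size = target-reached Enforcer pos th (subst (target ≤_) (+-identityʳ D) need)
    forced (suc e) pos L D th need size with target ≤? D
    ... | yes target≤D = target-reached Enforcer pos th target≤D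
    ... | no  target≰D =
      enforcer-reply pos th (≰⇒> target≰D)
        (≤-trans (+-monoʳ-≤ target (m≤n+m q p)) (≤-trans (target+p+q≤budget (suc e)) size))
        λ pos′ L′ c th′ size′ c≤q _ _ →
          any-junk e (forced e) (junk L′ pos′) pos′ ≤-refl th′ need (spend (budget e) (τ * q + q) size size′ c≤q)

    -- Even an initial deficit of 0 needs only `target` increases. The extra successor lets one
    -- budget serve both openings, as `any-junk` at `target` already assumes `suc target`.
    winningAt-suc : WinningAt ℓ (budget (suc target))
    winningAt-suc pl pos L safe bd size = start pl
      where
      D = ℓ * ∣ L ∣ ∸ weight L (res pos)
      th : Threat L pos D
      th = record { safe = safe ; bounded = bd ; balance = m+[n∸m]≡n (weight-≤ L bd) }
      start : ∀ pl → Wins pl pos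
      start Avoider = any-junk target (forced target) (junk L pos) pos ≤-refl th
        (≤-trans (n≤1+n target) (m≤n+m _ D)) (≤-trans (+-monoʳ-≤ (budget target) (m≤m+n _ q)) size)
      start Enforcer = forced (suc target) pos L D th (≤-trans (n≤1+n target) (m≤n+m _ D)) size

-- Induction on the box size.

-- The threshold `N` is fixed before the board, the labelling and the targets. The gcd condition
-- enters at each size `suc l ≤ k`, where it bounds the length of the residue cycle.
winning-threshold : ∀ p q k (1≤p : 1 ≤ p) (1≤q : 1 ≤ q) →
  ((ℓ : ℕ) → 1 ≤ ℓ → ℓ ≤ k → gcd (p + q) ℓ ≤ p) → ∀ ℓ → ℓ ≤ k →
  ∃[ N ] (∀ {m n} β (F : Fin n → Subset m) F⊆β → Play.WinningAt p q 1≤p 1≤q β F F⊆β ℓ N)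
winning-threshold p q k 1≤p 1≤q gcd≤p zero    _   = 1 , Play.winningAt-0 p q 1≤p 1≤q
winning-threshold p q k 1≤p 1≤q gcd≤p (suc l) ℓ≤k
  with winning-threshold p q k 1≤p 1≤q gcd≤p l (<⇒≤ ℓ≤k)
     | descend (p + q) (suc l) p (s≤s z≤n) (gcd≤p (suc l) (s≤s z≤n) ℓ≤k)
... | M , winning | τ , timing =
  boxBudget p q τ (suc l * M) (suc (suc l * M)) ,
  λ β F F⊆β → Play.Step.winningAt-suc p q 1≤p 1≤q β F F⊆β l M τ (winning β F F⊆β) timing

-- From labelled cells to boxes that are consecutive intervals.

labels : ∀ {n} (b : Fin n → ℕ) → Vec (Fin n) (total b)
labels {zero}  b = []
labels {suc n} b = replicate (b zero) zero ++ map suc (labels (b ∘ suc))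

lookup-labels : ∀ {n} (b : Fin n → ℕ) i x → offset b i ≤ toℕ x → toℕ x < offset b i + b i → lookup (labels b) x ≡ i
lookup-labels b zero x _ x<b =
  trans (lookup-++-< (replicate (b zero) zero) _ x x<b) (lookup-replicate (fromℕ< x<b) zero)
lookup-labels b (suc i) x o≤x x<o+b = begin
  lookup (labels b) x                      ≡⟨ lookup-++-≥ (replicate (b zero) zero) _ x b₀≤x ⟩
  lookup (map suc (labels (b ∘ suc))) y    ≡⟨ lookup-map y suc (labels (b ∘ suc)) ⟩
  suc (lookup (labels (b ∘ suc)) y)        ≡⟨ cong suc (lookup-labels (b ∘ suc) i y o≤y y<o+b) ⟩
  suc i                                    ∎
  where
  open ≡-Reasoning
  b₀≤x : b zero ≤ toℕ x
  b₀≤x = ≤-trans (m≤m+n (b zero) _) o≤x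
  y = reduce≥ x b₀≤x
  +-reduce≥ : ∀ k {l} (x : Fin (k + l)) .(k≤x : k ≤ toℕ x) → k + toℕ (reduce≥ x k≤x) ≡ toℕ x
  +-reduce≥ zero    x       _   = refl
  +-reduce≥ (suc k) (suc x) k≤x = cong suc (+-reduce≥ k x (s≤s⁻¹ k≤x))
  o≤y : offset (b ∘ suc) i ≤ toℕ y
  o≤y = +-cancelˡ-≤ (b zero) _ _ (≤-trans o≤x (≤-reflexive (sym (+-reduce≥ (b zero) x b₀≤x))))
  y<o+b : toℕ y < offset (b ∘ suc) i + b (suc i)
  y<o+b = +-cancelˡ-< (b zero) _ _ (subst₂ _<_ (sym (+-reduce≥ (b zero) x b₀≤x)) (+-assoc (b zero) _ _) x<o+b)

box⊆labels : ∀ {n} (b : Fin n → ℕ) i x → x ∈ box b i → lookup (labels b) x ≡ i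
box⊆labels b i x x∈box = lookup-labels b i x (≤ᵇ⇒≤ _ _ (proj₁ bounds)) (<ᵇ⇒< _ _ (proj₂ bounds))
  where
  toSide-T : ∀ {c} → toSide c ≡ inside → T c
  toSide-T {true} _ = _
  bounds = Equivalence.to T-∧ (toSide-T (trans (sym (lookup∘tabulate _ x)) ([]=⇒lookup x∈box)))

residuals-map-suc : ∀ {m n} (β : Vec (Fin n) m) →
  residuals (map suc β) (replicate m unclaimed) ≡ 0 ∷ residuals β (replicate m unclaimed)
residuals-map-suc []      = refl
residuals-map-suc (i ∷ β) = cong (λ v → updateAt v (suc i) suc) (residuals-map-suc β)

residuals-labels : ∀ {n} (b : Fin n → ℕ) → residuals (labels b) (replicate (total b) unclaimed) ≡ tabulate b
residuals-labels {zero}  b = refl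
residuals-labels {suc n} b = go (b zero)
  where
  go : ∀ k → residuals (replicate k zero ++ map suc (labels (b ∘ suc))) (replicate (k + total (b ∘ suc)) unclaimed)
           ≡ k ∷ tabulate (b ∘ suc)
  go zero    = trans (residuals-map-suc (labels (b ∘ suc))) (cong (0 ∷_) (residuals-labels (b ∘ suc)))
  go (suc k) = cong (λ v → updateAt v zero suc) (go k)

-- Supplies the first live set: boxes of small index, which monotonicity of the sizes keeps within
-- `k`.
initial : ∀ {N n} → N ≤ n → ∃[ L ] (N ≤ ∣ L ∣ × (∀ {i : Fin n} → i ∈ L → toℕ i < N))
initial {n = n} z≤n = ⊥ , z≤n , λ i∈⊥ → contradiction i∈⊥ ∉⊥
initial (s≤s N≤n) with initial N≤n
... | L , N≤L , below = inside ∷ L , s≤s N≤L , λ { here → s≤s z≤n ; (there i∈L) → s≤s (below i∈L) }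

theorem1p3 : (p q k : ℕ) → 1 ≤ p → 1 ≤ q → 1 ≤ k →
    ((ℓ : ℕ) → 1 ≤ ℓ → ℓ ≤ k → gcd (p + q) ℓ ≤ p) →
    Σ ℕ λ N →
    (n : ℕ) → (hn : suc N ≤ n) → (b : Fin n → ℕ) →
    ((i : Fin n) → 1 ≤ b i) →
    ((i j : Fin n) → i ≤ᶠ j → b i ≤ b j) →
    b (fromℕ< hn) ≤ k →
    EnforcerWinsMBox b p q Avoider × EnforcerWinsMBox b p q Enforcer
theorem1p3 p q k 1≤p 1≤q _ gcd≤p with winning-threshold p q k 1≤p 1≤q gcd≤p k ≤-refl
... | N , winning = N , λ n hn b _ mono b≤k → let L , N<L , below = initial hn in
  let start = λ pl → winning (labels b) (box b) (box⊆labels b) pl (replicate (total b) unclaimed) L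
                (λ x _ eq → contradiction (trans (sym (lookup-replicate x unclaimed)) eq) λ ())
                (λ {i} i∈L → begin
                  lookup (residuals (labels b) (replicate (total b) unclaimed)) i ≡⟨ cong (λ v → lookup v i) (residuals-labels b) ⟩
                  lookup (tabulate b) i ≡⟨ lookup∘tabulate b i ⟩
                  -- Indices start at 0, so `fromℕ< hn` is the box of index `N`, the `suc N`-th one;
                  -- members of `L` have index at most `N`.
                  b i            ≤⟨ mono i (fromℕ< hn) (≤-trans (s≤s⁻¹ (below i∈L)) (≤-reflexive (sym (toℕ-fromℕ< hn)))) ⟩
                  b (fromℕ< hn)  ≤⟨ b≤k ⟩
                  k              ∎)
                (<⇒≤ N<L)
  in start Avoider , start Enforcer
  where open ≤-Reasoning
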